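{- Every B&C architecture $\mathscr{A}=\langle A,\mathbf{R}^A\rangle$ is a modular architecture with $n$ modules for every positive integer $n$ with $n\le|A|$.
   Context: A boxes & connectors (B&C) architecture is a pair $\mathscr{A}=\langle A,\mathbf{R}^A\rangle$ where $A$ is a set (the universe) and $\mathbf{R}^A\subseteq\mathcal{P}(A^2)$ is a countable set of binary relations over $A$. One writes $R(a,b)$ for $(a,b)\in R$. An elementary modular architecture of $n$ modules is a B&C architecture $\mathscr{M}_n=\langle M_n,\{D^M\}\rangle$ where $M_n=\{m_1,\dots,m_n\}$ is a finite set with $n$ elements and $D^M\subseteq M_n\times M_n$ is a single (otherwise arbitrary) binary relation. A homomorphism $h:\langle A,\mathbf{R}^A\rangle\to\langle B,\mathbf{R}^B\rangle$ of B&C architectures is a pair $h=\langle h_0,h_R\rangle$ of maps $h_0:A\to B$ and $h_R:\mathbf{R}^A\to\mathbf{R}^B$ such that for every $R\in\mathbf{R}^A$ and $a_1,a_2\in A$: $R(a_1,a_2)\Rightarrow h_R(R)(h_0(a_1),h_0(a_2))$. It is called surjective if both $h_0$ and $h_R$ are surjective. A B&C architecture $\mathscr{A}$ is called a modular architecture with $n$ modules if there exists a surjective homomorphism $h:\mathscr{A}\to\mathscr{M}_n$ to some elementary modular architecture $\mathscr{M}_n$ of $n$ modules.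
   Formalization: The set of relations R^A is assumed non-empty: if R^A is empty, no map h_R from R^A to {D^M} is surjective, so the claim fails there (e.g. A a single point, R^A empty, n = 1). -}

module Defs where

open import Data.Fin.Base using (Fin)
open import Data.Nat.Base using (ℕ)
open import Data.Product.Base using (Σ; ∃; _×_; _,_; proj₁; proj₂; swap)
open import Function.Base using (id)
open import Function.Bundles using (Func; Injection)
open import Function.Definitions using (Surjective)
open import Level using (Level; _⊔_; suc; 0ℓ)
open import Relation.Binary.Bundles using (Setoid)
open import Relation.Binary.Core using (Rel; _⇔_)
open import Relation.Binary.Definitions using (_Respects_)
open import Relation.Binary.PropositionalEquality.Core using (_≡_; refl)
open import Relation.Binary.PropositionalEquality.Properties using (setoid)
import Relation.Binary.Construct.On as On
open import Relation.Unary using (Pred)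

private
  variable
    a b ℓ ℓ₁ ℓ₂ r r₁ r₂ : Level

-- Binary relations are compared by extension (R ⇔ S), as subsets of A × A are.
RelSetoid : (A : Set a) (ℓ : Level) → Setoid (a ⊔ suc ℓ) (a ⊔ ℓ)
RelSetoid A ℓ = record
  { Carrier       = Rel A ℓ
  ; _≈_           = _⇔_
  ; isEquivalence = record
    { refl  = id , id
    ; sym   = swap
    ; trans = λ (f , f′) (g , g′) → (λ p → g (f p)) , (λ p → f′ (g′ p))
    }
  }

Members : {A : Set a} → Pred (Rel A ℓ) r → Setoid (a ⊔ suc ℓ ⊔ r) (a ⊔ ℓ)
Members {ℓ = ℓ} {A = A} 𝐑 = On.setoid {B = Σ (Rel A ℓ) 𝐑} (RelSetoid A ℓ) proj₁

-- Finite sets of relations, including the empty one, count as countable.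
Countable : {A : Set a} → Pred (Rel A ℓ) r → Set (a ⊔ suc ℓ ⊔ r)
Countable 𝐑 = Injection (Members 𝐑) (setoid ℕ)

record Architecture (a ℓ r : Level) : Set (suc (a ⊔ ℓ ⊔ r)) where
  field
    Universe    : Set a
    Relations   : Pred (Rel Universe ℓ) r
    extensional : Relations Respects _⇔_
    countable   : Countable Relations

  members : Setoid (a ⊔ suc ℓ ⊔ r) (a ⊔ ℓ)
  members = Members Relations

open Architecture public

record Homomorphism (𝒜 : Architecture a ℓ₁ r₁) (ℬ : Architecture b ℓ₂ r₂)
                    : Set (a ⊔ b ⊔ suc ℓ₁ ⊔ suc ℓ₂ ⊔ r₁ ⊔ r₂) where
  field
    h₀        : Universe 𝒜 → Universe ℬ
    hᵣ        : Func (members 𝒜) (members ℬ)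
    preserves : (R : Setoid.Carrier (members 𝒜)) (a₁ a₂ : Universe 𝒜) →
                proj₁ R a₁ a₂ → proj₁ (Func.to hᵣ R) (h₀ a₁) (h₀ a₂)

IsSurjective : {𝒜 : Architecture a ℓ₁ r₁} {ℬ : Architecture b ℓ₂ r₂} →
               Homomorphism 𝒜 ℬ → Set (a ⊔ b ⊔ suc ℓ₁ ⊔ suc ℓ₂ ⊔ r₁ ⊔ r₂)
IsSurjective {𝒜 = 𝒜} {ℬ = ℬ} h =
  Surjective _≡_ _≡_ h₀ ×
  Surjective (Setoid._≈_ (members 𝒜)) (Setoid._≈_ (members ℬ)) (Func.to hᵣ)
  where open Homomorphism h

-- ⟨ {m₁, …, mₙ} , {D} ⟩, with Fin n as the set of modules.
elementary : (n : ℕ) → Rel (Fin n) ℓ → Architecture 0ℓ ℓ ℓ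
elementary n D = record
  { Universe    = Fin n
  ; Relations   = _⇔ D
  ; extensional = λ (f , g) (p , q) → (λ x → p (g x)) , (λ x → f (q x))
  ; countable   = record
    { to        = λ _ → 0
    ; cong      = λ _ → refl
    ; injective = λ { {_ , p , q} {_ , p′ , q′} _ →
                      (λ x → q′ (p x)) , (λ x → q (p′ x)) }
    }
  }

IsModular : Architecture a ℓ r → ℕ → Set (a ⊔ suc ℓ ⊔ r)
IsModular {ℓ = ℓ} 𝒜 n =
  ∃ λ (D : Rel (Fin n) ℓ) →
  ∃ λ (h : Homomorphism 𝒜 (elementary n D)) → IsSurjective h

{-# OPTIONS --safe #-}

-- Let D be the full relation on the modules: then any map of universes preserves
-- every relation, so a retraction of the given injection serves as h₀.
module Submission where

open import Defs
open import Axiom.ExcludedMiddle using (ExcludedMiddle)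
open import Data.Empty using (⊥-elim)
open import Data.Fin.Base using (Fin; zero)
open import Data.Nat.Base using (ℕ; NonZero; suc)
open import Data.Product.Base using (∃; _,_; swap)
open import Data.Unit.Polymorphic.Base using (tt)
open import Function.Base using (id)
open import Function.Bundles using (_↣_; module Injection)
open import Function.Definitions using (StrictlyInverseʳ)
open import Level using (Level)
open import Relation.Binary.Construct.Always using (Always)
open import Relation.Binary.PropositionalEquality.Core using (_≡_; refl)
open import Relation.Nullary.Decidable.Core using (yes; no)
open import Relation.Unary using (Satisfiable)

-- The target has a single relation up to `_⇔_`, so `hᵣ` is constant, and it is onto because `𝒜` has
-- at least one relation. What remains is to make `h₀` onto: a left inverse of an injection is
-- surjective, and classically one exists when the domain is nonempty.

retraction : {a : Level} {A : Set a} {B : Set} → ExcludedMiddle a → B → (f : B ↣ A) →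
             ∃ λ g → StrictlyInverseʳ _≡_ (Injection.to f) g
retraction {A = A} {B} em b₀ f = g , g∘f
  where
  open Injection f using (to; injective)

  g : A → B
  -- Being in the image of `f` is undecidable in general; points outside it go to the default `b₀`.
  g x with em {∃ λ b → to b ≡ x}
  ... | yes (b , _) = b
  ... | no _        = b₀

  g∘f : StrictlyInverseʳ _≡_ to g
  g∘f b with em {∃ λ b′ → to b′ ≡ to b}
  -- The preimage that `em` returns for `to b` is some `b′`; injectivity identifies it with `b`.
  ... | yes (_ , eq) = injective eq
  ... | no ∄b        = ⊥-elim (∄b (b , refl))

theorem3 : {a ℓ r : Level} → ExcludedMiddle a →
    (𝒜 : Architecture a ℓ r) → Satisfiable (Relations 𝒜) →
    (n : ℕ) → .{{_ : NonZero n}} → (Fin n ↣ Universe 𝒜) →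
    IsModular 𝒜 n
theorem3 em 𝒜 R (suc n) f with retraction em zero f
... | g , g∘f = Always , h , (λ i → Injection.to f i , λ { refl → g∘f i })
                           -- Every target relation `S` is equivalent to `Always`, so the one
                           -- witness `R` serves for all.
                           , (λ (_ , S⇔D) → R , λ _ → swap S⇔D)
  where
  h : Homomorphism 𝒜 (elementary (suc n) Always)
  h = record
    { h₀        = g
    ; hᵣ        = record { to = λ _ → Always , id , id ; cong = λ _ → id , id }
    ; preserves = λ _ _ _ _ → tt
    }
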